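{- Let $n$ be a positive integer. Then $\mathbb{Q}(\alpha) \neq \mathbb{Q}(\beta)$ holds for all $\alpha, \beta \in I_n^{2,i}$ with $\alpha \neq \beta$.
   Context: For a positive integer $c$, $\sqrt{ -c}$ denotes $\sqrt{c}\,\sqrt{ -1}$ (the root with positive imaginary part), and likewise $\sqrt{1-4c} = \sqrt{4c-1}\,\sqrt{ -1}$. For an integer $n \ge 1$ define $$I_n^{2,i} := \left\{\tfrac{1+\sqrt{1-4c}}{2} \in \mathbb{C}\setminus\mathbb{R} \;\middle|\; c \in \mathbb{Z},\ \left(\tfrac{n-1}{2}\right)^2+1 \le c \le \left(\tfrac{n+1}{2}\right)^2\right\} \quad \text{if } n \text{ is odd},$$ $$I_n^{2,i} := \left\{\sqrt{ -c} \in \mathbb{C}\setminus\mathbb{R} \;\middle|\; c \in \mathbb{Z},\ \left(\tfrac{n}{2}\right)^2 < c < \left(\tfrac{n}{2}+1\right)^2\right\} \quad \text{if } n \text{ is even}.$$ $\mathbb{Q}(\alpha)$ denotes the subfield of $\mathbb{C}$ generated by $\alpha$. -}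

module Defs where

open import Data.Integer.Base as ℤ using (ℤ; +_; -[1+_]; +<+; +≤+)
import Data.Integer.Properties as ℤ
open import Data.Nat.Base as ℕ using (ℕ; zero; suc; s≤s; z≤n)
import Data.Nat.DivMod as ℕ
open import Data.Nat.Divisibility using (_∣_; _∤_)
import Data.Nat.Properties as ℕ
open import Data.Nat.Tactic.RingSolver using (solve-∀)
open import Data.Product.Base using (∃; _×_; _,_; proj₁; proj₂)
open import Data.Rational.Base as ℚ using (ℚ; 0ℚ; 1ℚ; ½; mkℚ; ∣_∣; toℚᵘ; fromℚᵘ)
import Data.Rational.Properties as ℚ
open import Data.Rational.Solver using (module +-*-Solver)
open import Data.Rational.Unnormalised.Base as ℚᵘ using (mkℚᵘ; *<*; *≤*)
import Data.Rational.Unnormalised.Properties as ℚᵘ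
open import Data.Sum.Base using (inj₁; inj₂)
open import Level using (0ℓ)
open import Relation.Binary.PropositionalEquality
open import Relation.Nullary using (¬_; yes; no; contradiction)
open import Relation.Unary using (Pred)

private
  half+half : ∀ ε → ½ ℚ.* ε ℚ.+ ½ ℚ.* ε ≡ ε
  half+half ε = trans (sym (ℚ.*-distribʳ-+ ε ½ ½)) (ℚ.*-identityˡ ε)

  half-pos : ∀ {ε} → 0ℚ ℚ.< ε → 0ℚ ℚ.< ½ ℚ.* ε
  half-pos {ε} 0<ε = subst (ℚ._< ½ ℚ.* ε) (ℚ.*-zeroʳ ½) (ℚ.*-monoʳ-<-pos ½ 0<ε)

  ∣·∣<-intro : ∀ {p q} → p ℚ.< q → ℚ.- p ℚ.< q → ∣ p ∣ ℚ.< q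
  ∣·∣<-intro {p} p<q -p<q with ℚ.∣p∣≡p∨∣p∣≡-p p
  ... | inj₁ eq = subst (ℚ._< _) (sym eq) p<q
  ... | inj₂ eq = subst (ℚ._< _) (sym eq) -p<q

  quotient : ∀ B {ε} → 0ℚ ℚ.< B → 0ℚ ℚ.< ε → ∃ λ δ → 0ℚ ℚ.< δ × B ℚ.* δ ≡ ε
  quotient B {ε} 0<B 0<ε = δ , ℚ.positive⁻¹ δ {{pos}} , eq
    where
    instance
      B>0 : ℚ.Positive B
      B>0 = ℚ.positive 0<B
      B≢0 : ℚ.NonZero B
      B≢0 = ℚ.pos⇒nonZero B
    δ = ℚ.1/ B ℚ.* ε
    pos = ℚ.pos*pos⇒pos (ℚ.1/ B) {{ℚ.1/pos⇒pos B}} ε {{ℚ.positive 0<ε}}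
    eq : B ℚ.* δ ≡ ε
    eq = trans (sym (ℚ.*-assoc B (ℚ.1/ B) ε))
        (trans (cong (ℚ._* ε) (ℚ.*-inverseʳ B)) (ℚ.*-identityˡ ε))

  *-mono-bound : ∀ {p q B δ} → 0ℚ ℚ.< B → ∣ p ∣ ℚ.≤ B → ∣ q ∣ ℚ.< δ → ∣ p ℚ.* q ∣ ℚ.< B ℚ.* δ
  *-mono-bound {p} {q} {B} {δ} 0<B p≤B q<δ = begin-strict
    ∣ p ℚ.* q ∣        ≡⟨ ℚ.∣p*q∣≡∣p∣*∣q∣ p q ⟩
    ∣ p ∣ ℚ.* ∣ q ∣    ≤⟨ ℚ.*-monoʳ-≤-nonNeg ∣ q ∣ {{ℚ.∣-∣-nonNeg q}} p≤B ⟩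
    B ℚ.* ∣ q ∣        <⟨ ℚ.*-monoʳ-<-pos B {{ℚ.positive 0<B}} q<δ ⟩
    B ℚ.* δ            ∎
    where open ℚ.≤-Reasoning

-- Real numbers are Cauchy sequences of rationals; _≈ᴿ_ identifies sequences
-- whose difference is a null sequence.

IsCauchy : (ℕ → ℚ) → Set
IsCauchy x = ∀ ε → 0ℚ ℚ.< ε →
  ∃ λ N → ∀ m n → N ℕ.≤ m → N ℕ.≤ n → ∣ x m ℚ.- x n ∣ ℚ.< ε

record ℝ : Set where
  constructor mkℝ
  field
    seq    : ℕ → ℚ
    cauchy : IsCauchy seq

open ℝ public

infix 4 _≈ᴿ_
infixl 6 _+ᴿ_
infixl 7 _*ᴿ_
infix 8 -ᴿ_

_≈ᴿ_ : ℝ → ℝ → Set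
x ≈ᴿ y = ∀ ε → 0ℚ ℚ.< ε → ∃ λ N → ∀ n → N ℕ.≤ n → ∣ seq x n ℚ.- seq y n ∣ ℚ.< ε

fromℚ : ℚ → ℝ
fromℚ p = mkℝ (λ _ → p) λ ε 0<ε → 0 , λ _ _ _ _ →
  subst (ℚ._< ε) (sym (cong ∣_∣ (ℚ.+-inverseʳ p))) 0<ε

_+ᴿ_ : ℝ → ℝ → ℝ
x +ᴿ y = mkℝ (λ n → seq x n ℚ.+ seq y n) λ ε 0<ε →
  let M , x-close = cauchy x (½ ℚ.* ε) (half-pos 0<ε)
      N , y-close = cauchy y (½ ℚ.* ε) (half-pos 0<ε)
  in M ℕ.⊔ N , λ m n m≥ n≥ → let open ℚ.≤-Reasoning; open +-*-Solver in begin-strict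
    ∣ (seq x m ℚ.+ seq y m) ℚ.- (seq x n ℚ.+ seq y n) ∣
      ≡⟨ cong ∣_∣ (solve 4 (λ a b c d → (a :+ b) :- (c :+ d) := (a :- c) :+ (b :- d))
           refl (seq x m) (seq y m) (seq x n) (seq y n)) ⟩
    ∣ (seq x m ℚ.- seq x n) ℚ.+ (seq y m ℚ.- seq y n) ∣
      ≤⟨ ℚ.∣p+q∣≤∣p∣+∣q∣ (seq x m ℚ.- seq x n) (seq y m ℚ.- seq y n) ⟩
    ∣ seq x m ℚ.- seq x n ∣ ℚ.+ ∣ seq y m ℚ.- seq y n ∣
      <⟨ ℚ.+-mono-< (x-close m n (ℕ.m⊔n≤o⇒m≤o M N m≥) (ℕ.m⊔n≤o⇒m≤o M N n≥))
                    (y-close m n (ℕ.m⊔n≤o⇒n≤o M N m≥) (ℕ.m⊔n≤o⇒n≤o M N n≥)) ⟩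
    ½ ℚ.* ε ℚ.+ ½ ℚ.* ε
      ≡⟨ half+half ε ⟩
    ε ∎

-ᴿ_ : ℝ → ℝ
-ᴿ x = mkℝ (λ n → ℚ.- seq x n) λ ε 0<ε →
  let N , x-close = cauchy x ε 0<ε
  in N , λ m n m≥ n≥ → subst (ℚ._< ε)
    (trans (sym (ℚ.∣-p∣≡∣p∣ (seq x m ℚ.- seq x n)))
           (cong ∣_∣ (ℚ.neg-distrib-+ (seq x m) (ℚ.- seq x n))))
    (x-close m n m≥ n≥)

eventually-bounded : ∀ x → ∃ λ B → 0ℚ ℚ.< B × ∃ λ N → ∀ n → N ℕ.≤ n → ∣ seq x n ∣ ℚ.≤ B
eventually-bounded x = B , 0<B , N , bound
  where
  0<1 : 0ℚ ℚ.< 1ℚ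
  0<1 = ℚ.positive⁻¹ 1ℚ
  N = proj₁ (cauchy x 1ℚ 0<1)
  B = 1ℚ ℚ.+ ∣ seq x N ∣
  0<B : 0ℚ ℚ.< B
  0<B = ℚ.+-mono-<-≤ 0<1 (ℚ.nonNegative⁻¹ ∣ seq x N ∣ {{ℚ.∣-∣-nonNeg (seq x N)}})
  bound : ∀ n → N ℕ.≤ n → ∣ seq x n ∣ ℚ.≤ B
  bound n n≥ = let open ℚ.≤-Reasoning; open +-*-Solver in begin
    ∣ seq x n ∣
      ≡⟨ cong ∣_∣ (solve 2 (λ a b → a := (a :- b) :+ b) refl (seq x n) (seq x N)) ⟩
    ∣ (seq x n ℚ.- seq x N) ℚ.+ seq x N ∣
      ≤⟨ ℚ.∣p+q∣≤∣p∣+∣q∣ (seq x n ℚ.- seq x N) (seq x N) ⟩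
    ∣ seq x n ℚ.- seq x N ∣ ℚ.+ ∣ seq x N ∣
      ≤⟨ ℚ.+-monoˡ-≤ ∣ seq x N ∣ (ℚ.<⇒≤ (proj₂ (cauchy x 1ℚ 0<1) n N n≥ ℕ.≤-refl)) ⟩
    B ∎

_*ᴿ_ : ℝ → ℝ → ℝ
x *ᴿ y = mkℝ (λ n → seq x n ℚ.* seq y n) λ ε 0<ε →
  let B , 0<B , K , x-bound = eventually-bounded x
      C , 0<C , L , y-bound = eventually-bounded y
      δ , 0<δ , Cδ≡ = quotient C 0<C (half-pos 0<ε)
      η , 0<η , Bη≡ = quotient B 0<B (half-pos 0<ε)
      M , x-close = cauchy x δ 0<δ
      N , y-close = cauchy y η 0<η
      KL = K ℕ.⊔ L
      MN = M ℕ.⊔ N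
  in KL ℕ.⊔ MN , λ m n m≥ n≥ →
    let m≥KL = ℕ.m⊔n≤o⇒m≤o KL MN m≥
        m≥MN = ℕ.m⊔n≤o⇒n≤o KL MN m≥
        n≥KL = ℕ.m⊔n≤o⇒m≤o KL MN n≥
        n≥MN = ℕ.m⊔n≤o⇒n≤o KL MN n≥
        open ℚ.≤-Reasoning
        open +-*-Solver
    in begin-strict
    ∣ seq x m ℚ.* seq y m ℚ.- seq x n ℚ.* seq y n ∣
      ≡⟨ cong ∣_∣ (solve 4 (λ a b c d → a :* b :- c :* d := d :* (a :- c) :+ a :* (b :- d))
           refl (seq x m) (seq y m) (seq x n) (seq y n)) ⟩
    ∣ seq y n ℚ.* (seq x m ℚ.- seq x n) ℚ.+ seq x m ℚ.* (seq y m ℚ.- seq y n) ∣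
      ≤⟨ ℚ.∣p+q∣≤∣p∣+∣q∣ (seq y n ℚ.* (seq x m ℚ.- seq x n)) (seq x m ℚ.* (seq y m ℚ.- seq y n)) ⟩
    ∣ seq y n ℚ.* (seq x m ℚ.- seq x n) ∣ ℚ.+ ∣ seq x m ℚ.* (seq y m ℚ.- seq y n) ∣
      <⟨ ℚ.+-mono-<
           (*-mono-bound {seq y n} 0<C (y-bound n (ℕ.m⊔n≤o⇒n≤o K L n≥KL))
             (x-close m n (ℕ.m⊔n≤o⇒m≤o M N m≥MN) (ℕ.m⊔n≤o⇒m≤o M N n≥MN)))
           (*-mono-bound {seq x m} 0<B (x-bound m (ℕ.m⊔n≤o⇒m≤o K L m≥KL))
             (y-close m n (ℕ.m⊔n≤o⇒n≤o M N m≥MN) (ℕ.m⊔n≤o⇒n≤o M N n≥MN))) ⟩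
    C ℚ.* δ ℚ.+ B ℚ.* η
      ≡⟨ cong₂ ℚ._+_ Cδ≡ Bη≡ ⟩
    ½ ℚ.* ε ℚ.+ ½ ℚ.* ε
      ≡⟨ half+half ε ⟩
    ε ∎

-- isqrt n = ⌊√n⌋
isqrt : ℕ → ℕ
isqrt zero    = 0
isqrt (suc n) with suc (isqrt n) ℕ.* suc (isqrt n) ℕ.≤? suc n
... | yes _ = suc (isqrt n)
... | no  _ = isqrt n

isqrt-lower : ∀ n → isqrt n ℕ.* isqrt n ℕ.≤ n
isqrt-lower zero = z≤n
isqrt-lower (suc n) with suc (isqrt n) ℕ.* suc (isqrt n) ℕ.≤? suc n
... | yes p = p
... | no  _ = ℕ.m≤n⇒m≤1+n (isqrt-lower n)

isqrt-upper : ∀ n → n ℕ.< suc (isqrt n) ℕ.* suc (isqrt n)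
isqrt-upper zero = s≤s z≤n
isqrt-upper (suc n) with suc (isqrt n) ℕ.* suc (isqrt n) ℕ.≤? suc n
... | no ¬p = ℕ.≰⇒> ¬p
... | yes _ = ℕ.≤-<-trans (isqrt-upper n)
                (ℕ.*-mono-< (ℕ.n<1+n (suc (isqrt n))) (ℕ.n<1+n (suc (isqrt n))))

-- ⌊√c · (k + 1)⌋, the numerator of the k-th approximation to √c
√-num : ℕ → ℕ → ℕ
√-num c k = isqrt (c ℕ.* (suc k ℕ.* suc k))

√-seq : ℕ → ℕ → ℚ
√-seq c k = + √-num c k ℚ./ suc k

private
  square-cancel-< : ∀ {a b} → a ℕ.* a ℕ.< b ℕ.* b → a ℕ.< b
  square-cancel-< {a} {b} aa<bb with a ℕ.<? b
  ... | yes a<b = a<b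
  ... | no  a≮b = let b≤a = ℕ.≮⇒≥ a≮b in
    contradiction (ℕ.*-mono-≤ b≤a b≤a) (ℕ.<⇒≱ aa<bb)

  /-mono-< : ∀ a b j k → a ℕ.* suc k ℕ.< b ℕ.* suc j → + a ℚ./ suc j ℚ.< + b ℚ./ suc k
  /-mono-< a b j k lt = ℚ.toℚᵘ-cancel-< (begin-strict
    toℚᵘ (fromℚᵘ (mkℚᵘ (+ a) j)) ≃⟨ ℚ.toℚᵘ-fromℚᵘ (mkℚᵘ (+ a) j) ⟩
    mkℚᵘ (+ a) j                 <⟨ *<* (subst₂ ℤ._<_ (ℤ.pos-* a (suc k)) (ℤ.pos-* b (suc j)) (+<+ lt)) ⟩
    mkℚᵘ (+ b) k                 ≃⟨ ℚ.toℚᵘ-fromℚᵘ (mkℚᵘ (+ b) k) ⟨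
    toℚᵘ (fromℚᵘ (mkℚᵘ (+ b) k)) ∎)
    where open ℚᵘ.≤-Reasoning

  /-+ : ∀ a b k → + (a ℕ.+ b) ℚ./ suc k ≡ + a ℚ./ suc k ℚ.+ + b ℚ./ suc k
  /-+ a b k = ℚ.toℚᵘ-injective (begin
    toℚᵘ (fromℚᵘ (mkℚᵘ (+ (a ℕ.+ b)) k))
      ≈⟨ ℚ.toℚᵘ-fromℚᵘ (mkℚᵘ (+ (a ℕ.+ b)) k) ⟩
    mkℚᵘ (+ (a ℕ.+ b)) k
      ≈⟨ ℚᵘ.*≡* eq ⟩
    mkℚᵘ (+ a) k ℚᵘ.+ mkℚᵘ (+ b) k
      ≈⟨ ℚᵘ.+-cong (ℚ.toℚᵘ-fromℚᵘ (mkℚᵘ (+ a) k)) (ℚ.toℚᵘ-fromℚᵘ (mkℚᵘ (+ b) k)) ⟨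
    toℚᵘ (fromℚᵘ (mkℚᵘ (+ a) k)) ℚᵘ.+ toℚᵘ (fromℚᵘ (mkℚᵘ (+ b) k))
      ≈⟨ ℚ.toℚᵘ-homo-+ (fromℚᵘ (mkℚᵘ (+ a) k)) (fromℚᵘ (mkℚᵘ (+ b) k)) ⟨
    toℚᵘ (fromℚᵘ (mkℚᵘ (+ a) k) ℚ.+ fromℚᵘ (mkℚᵘ (+ b) k)) ∎)
    where
    open import Relation.Binary.Reasoning.Setoid ℚᵘ.≃-setoid
    eq : + (a ℕ.+ b) ℤ.* + (suc k ℕ.* suc k) ≡ (+ a ℤ.* + suc k ℤ.+ + b ℤ.* + suc k) ℤ.* + suc k
    eq = trans (cong (+ (a ℕ.+ b) ℤ.*_) (ℤ.pos-* (suc k) (suc k)))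
        (trans (sym (ℤ.*-assoc (+ (a ℕ.+ b)) (+ suc k) (+ suc k)))
               (cong (ℤ._* + suc k) (ℤ.*-distribʳ-+ (+ suc k) (+ a) (+ b))))

  archimedean : ∀ ε → 0ℚ ℚ.< ε → ∃ λ N → ∀ n → N ℕ.≤ n → + 1 ℚ./ suc n ℚ.< ε
  archimedean ε@(mkℚ (+ suc p) d _) 0<ε = suc d , λ n n≥ → ℚ.toℚᵘ-cancel-< (begin-strict
    toℚᵘ (fromℚᵘ (mkℚᵘ (+ 1) n)) ≃⟨ ℚ.toℚᵘ-fromℚᵘ (mkℚᵘ (+ 1) n) ⟩
    mkℚᵘ (+ 1) n                 <⟨ *<* (+<+ (lt n n≥)) ⟩
    mkℚᵘ (+ suc p) d             ∎)
    where
    open ℚᵘ.≤-Reasoning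
    lt : ∀ n → suc d ℕ.≤ n → 1 ℕ.* suc d ℕ.< suc p ℕ.* suc n
    lt n n≥ = ℕ.≤-trans (s≤s (subst (ℕ._≤ n) (sym (ℕ.*-identityˡ (suc d))) n≥))
                         (ℕ.m≤m+n (suc n) (p ℕ.* suc n))
  archimedean (mkℚ (+ zero)  _ _) 0<ε with () ← ℚ.positive 0<ε
  archimedean (mkℚ -[1+ _ ] _ _) 0<ε with () ← ℚ.positive 0<ε

  √-cross : ∀ c m n → √-num c m ℕ.* suc n ℕ.< suc (√-num c n) ℕ.* suc m
  √-cross c m n = square-cancel-< (begin-strict
    (a ℕ.* suc n) ℕ.* (a ℕ.* suc n)
      ≡⟨ sq a (suc n) ⟩
    (a ℕ.* a) ℕ.* (suc n ℕ.* suc n)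
      ≤⟨ ℕ.*-monoˡ-≤ (suc n ℕ.* suc n) (isqrt-lower (c ℕ.* (suc m ℕ.* suc m))) ⟩
    c ℕ.* (suc m ℕ.* suc m) ℕ.* (suc n ℕ.* suc n)
      ≡⟨ swap c (suc m ℕ.* suc m) (suc n ℕ.* suc n) ⟩
    c ℕ.* (suc n ℕ.* suc n) ℕ.* (suc m ℕ.* suc m)
      <⟨ ℕ.*-monoˡ-< (suc m ℕ.* suc m) (isqrt-upper (c ℕ.* (suc n ℕ.* suc n))) ⟩
    (suc b ℕ.* suc b) ℕ.* (suc m ℕ.* suc m)
      ≡⟨ sq (suc b) (suc m) ⟨
    (suc b ℕ.* suc m) ℕ.* (suc b ℕ.* suc m) ∎)
    where
    open ℕ.≤-Reasoning
    a = √-num c m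
    b = √-num c n
    sq : ∀ x y → (x ℕ.* y) ℕ.* (x ℕ.* y) ≡ (x ℕ.* x) ℕ.* (y ℕ.* y)
    sq = solve-∀
    swap : ∀ c x y → c ℕ.* x ℕ.* y ≡ c ℕ.* y ℕ.* x
    swap = solve-∀

  √-close : ∀ c m n → √-seq c m ℚ.- √-seq c n ℚ.< + 1 ℚ./ suc n
  √-close c m n = begin-strict
    √-seq c m ℚ.- √-seq c n
      <⟨ ℚ.+-monoˡ-< (ℚ.- √-seq c n)
           (/-mono-< (√-num c m) (√-num c n ℕ.+ 1) m n (subst (λ t → √-num c m ℕ.* suc n ℕ.< t ℕ.* suc m)
             (ℕ.+-comm 1 (√-num c n)) (√-cross c m n))) ⟩
    + (√-num c n ℕ.+ 1) ℚ./ suc n ℚ.- √-seq c n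
      ≡⟨ cong (ℚ._- √-seq c n) (/-+ (√-num c n) 1 n) ⟩
    (√-seq c n ℚ.+ + 1 ℚ./ suc n) ℚ.- √-seq c n
      ≡⟨ solve 2 (λ p q → (p :+ q) :- p := q) refl (√-seq c n) (+ 1 ℚ./ suc n) ⟩
    + 1 ℚ./ suc n ∎
    where
    open ℚ.≤-Reasoning
    open +-*-Solver

√ᴿ : ℕ → ℝ
√ᴿ c = mkℝ (√-seq c) λ ε 0<ε →
  let N , small = archimedean ε 0<ε
  in N , λ m n m≥ n≥ → ∣·∣<-intro
       (ℚ.<-trans (√-close c m n) (small n n≥))
       (subst (ℚ._< ε) (flip (√-seq c n) (√-seq c m)) (ℚ.<-trans (√-close c n m) (small m m≥)))
  where
  flip : ∀ p q → p ℚ.- q ≡ ℚ.- (q ℚ.- p)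
  flip = let open +-*-Solver in solve 2 (λ p q → p :- q := :- (q :- p)) refl

private
  toℚᵘ-square : ∀ a k → toℚᵘ (+ a ℚ./ suc k ℚ.* (+ a ℚ./ suc k)) ℚᵘ.≃ mkℚᵘ (+ a) k ℚᵘ.* mkℚᵘ (+ a) k
  toℚᵘ-square a k = ℚᵘ.≃-trans (ℚ.toℚᵘ-homo-* (+ a ℚ./ suc k) (+ a ℚ./ suc k))
    (ℚᵘ.*-cong (ℚ.toℚᵘ-fromℚᵘ (mkℚᵘ (+ a) k)) (ℚ.toℚᵘ-fromℚᵘ (mkℚᵘ (+ a) k)))

  square-≤ : ∀ a c k → a ℕ.* a ℕ.≤ c ℕ.* (suc k ℕ.* suc k) →
             + a ℚ./ suc k ℚ.* (+ a ℚ./ suc k) ℚ.≤ + c ℚ./ 1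
  square-≤ a c k le = ℚ.toℚᵘ-cancel-≤ (begin
    toℚᵘ (+ a ℚ./ suc k ℚ.* (+ a ℚ./ suc k)) ≃⟨ toℚᵘ-square a k ⟩
    mkℚᵘ (+ a) k ℚᵘ.* mkℚᵘ (+ a) k           ≤⟨ *≤* (subst₂ ℤ._≤_
      (trans (ℤ.pos-* a a) (sym (ℤ.*-identityʳ (+ a ℤ.* + a))))
      (ℤ.pos-* c (suc k ℕ.* suc k)) (+≤+ le)) ⟩
    mkℚᵘ (+ c) 0                             ≃⟨ ℚ.toℚᵘ-fromℚᵘ (mkℚᵘ (+ c) 0) ⟨
    toℚᵘ (+ c ℚ./ 1)                         ∎)
    where open ℚᵘ.≤-Reasoning

  square-> : ∀ b c k → c ℕ.* (suc k ℕ.* suc k) ℕ.< b ℕ.* b →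
             + c ℚ./ 1 ℚ.< + b ℚ./ suc k ℚ.* (+ b ℚ./ suc k)
  square-> b c k lt = ℚ.toℚᵘ-cancel-< (begin-strict
    toℚᵘ (+ c ℚ./ 1)                         ≃⟨ ℚ.toℚᵘ-fromℚᵘ (mkℚᵘ (+ c) 0) ⟩
    mkℚᵘ (+ c) 0                             <⟨ *<* (subst₂ ℤ._<_
      (ℤ.pos-* c (suc k ℕ.* suc k))
      (trans (ℤ.pos-* b b) (sym (ℤ.*-identityʳ (+ b ℤ.* + b)))) (+<+ lt)) ⟩
    mkℚᵘ (+ b) k ℚᵘ.* mkℚᵘ (+ b) k           ≃⟨ toℚᵘ-square b k ⟨
    toℚᵘ (+ b ℚ./ suc k ℚ.* (+ b ℚ./ suc k)) ∎)
    where open ℚᵘ.≤-Reasoning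

√ᴿ-nonneg : ∀ c k → 0ℚ ℚ.≤ seq (√ᴿ c) k
√ᴿ-nonneg c k = ℚ.nonNegative⁻¹ (√-seq c k) {{ℚ.normalize-nonNeg (√-num c k) (suc k)}}

√ᴿ-square : ∀ c → √ᴿ c *ᴿ √ᴿ c ≈ᴿ fromℚ (+ c ℚ./ 1)
√ᴿ-square c ε 0<ε =
  let B , 0<B , M , bound = eventually-bounded (√ᴿ c)
      D = (B ℚ.+ B) ℚ.+ 1ℚ
      0<D = ℚ.+-mono-< (ℚ.+-mono-< 0<B 0<B) (ℚ.positive⁻¹ 1ℚ)
      δ , 0<δ , Dδ≡ε = quotient D 0<D 0<ε
      N , small  = archimedean δ 0<δ
      N₁ , small₁ = archimedean 1ℚ (ℚ.positive⁻¹ 1ℚ)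
  in M ℕ.⊔ (N ℕ.⊔ N₁) , λ n n≥ →
    let n≥M  = ℕ.m⊔n≤o⇒m≤o M (N ℕ.⊔ N₁) n≥
        n≥NN = ℕ.m⊔n≤o⇒n≤o M (N ℕ.⊔ N₁) n≥
        x = √-seq c n
        u = + 1 ℚ./ suc n
        q = + c ℚ./ 1
        a = √-num c n
        x≤B : x ℚ.≤ B
        x≤B = subst (ℚ._≤ B) (ℚ.0≤p⇒∣p∣≡p (√ᴿ-nonneg c n)) (bound n n≥M)
        lower = square-≤ a c n (isqrt-lower (c ℕ.* (suc n ℕ.* suc n)))
        upper : q ℚ.< (x ℚ.+ u) ℚ.* (x ℚ.+ u)
        upper = subst (λ t → q ℚ.< t ℚ.* t)
          (trans (cong (λ t → + t ℚ./ suc n) (ℕ.+-comm 1 a)) (/-+ a 1 n))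
          (square-> (suc a) c n (isqrt-upper (c ℕ.* (suc n ℕ.* suc n))))
        open ℚ.≤-Reasoning
        open +-*-Solver
    in ∣·∣<-intro
      (ℚ.≤-<-trans (subst (x ℚ.* x ℚ.- q ℚ.≤_) (ℚ.+-inverseʳ q) (ℚ.+-monoˡ-≤ (ℚ.- q) lower)) 0<ε)
      (begin-strict
        ℚ.- (x ℚ.* x ℚ.- q)
          ≡⟨ solve 2 (λ x q → :- (x :* x :- q) := q :- x :* x) refl x q ⟩
        q ℚ.- x ℚ.* x
          <⟨ ℚ.+-monoˡ-< (ℚ.- (x ℚ.* x)) upper ⟩
        (x ℚ.+ u) ℚ.* (x ℚ.+ u) ℚ.- x ℚ.* x
          ≡⟨ solve 2 (λ x u → (x :+ u) :* (x :+ u) :- x :* x := u :* ((x :+ x) :+ u)) refl x u ⟩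
        u ℚ.* ((x ℚ.+ x) ℚ.+ u)
          ≤⟨ ℚ.*-monoˡ-≤-nonNeg u {{ℚ.normalize-nonNeg 1 (suc n)}}
               (ℚ.+-mono-≤ (ℚ.+-mono-≤ x≤B x≤B)
                 (ℚ.<⇒≤ (small₁ n (ℕ.m⊔n≤o⇒n≤o N N₁ n≥NN)))) ⟩
        u ℚ.* D
          <⟨ ℚ.*-monoˡ-<-pos D {{ℚ.positive 0<D}} (small n (ℕ.m⊔n≤o⇒m≤o N N₁ n≥NN)) ⟩
        δ ℚ.* D
          ≡⟨ trans (ℚ.*-comm δ D) Dδ≡ε ⟩
        ε ∎)

record ℂ : Set where
  constructor _+i_
  field
    re im : ℝ

open ℂ public

infix 4 _≈_ _≉_
infix 5 _+i_
infixl 6 _+_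
infixl 7 _*_
infix 8 -_

_≈_ _≉_ : ℂ → ℂ → Set
z ≈ w = re z ≈ᴿ re w × im z ≈ᴿ im w
z ≉ w = ¬ (z ≈ w)

_+_ _*_ : ℂ → ℂ → ℂ
z + w = (re z +ᴿ re w) +i (im z +ᴿ im w)
z * w = (re z *ᴿ re w +ᴿ -ᴿ (im z *ᴿ im w)) +i (re z *ᴿ im w +ᴿ im z *ᴿ re w)

-_ : ℂ → ℂ
- z = (-ᴿ re z) +i (-ᴿ im z)

ι : ℚ → ℂ
ι p = fromℚ p +i fromℚ 0ℚ

IsReal : Pred ℂ 0ℓ
IsReal z = im z ≈ᴿ fromℚ 0ℚ

-- The principal root: for negative integers, the one with positive imaginary part.
√ : ℤ → ℂ
√ (+ c)    = √ᴿ c +i fromℚ 0ℚ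
√ -[1+ c ] = fromℚ 0ℚ +i √ᴿ (suc c)

-- The subfield of ℂ generated by α.  The constructor ⁻¹-closed puts the
-- inverse of every invertible member in the subfield; ≈-closed makes it a
-- predicate on complex numbers up to _≈_.
data ℚ⟨_⟩ (α : ℂ) : Pred ℂ 0ℓ where
  generator  : ℚ⟨ α ⟩ α
  1-closed   : ℚ⟨ α ⟩ (ι 1ℚ)
  +-closed   : ∀ {z w} → ℚ⟨ α ⟩ z → ℚ⟨ α ⟩ w → ℚ⟨ α ⟩ (z + w)
  neg-closed : ∀ {z} → ℚ⟨ α ⟩ z → ℚ⟨ α ⟩ (- z)
  *-closed   : ∀ {z w} → ℚ⟨ α ⟩ z → ℚ⟨ α ⟩ w → ℚ⟨ α ⟩ (z * w)
  ⁻¹-closed  : ∀ {z w} → ℚ⟨ α ⟩ z → z * w ≈ ι 1ℚ → ℚ⟨ α ⟩ w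
  ≈-closed   : ∀ {z w} → z ≈ w → ℚ⟨ α ⟩ z → ℚ⟨ α ⟩ w

-- The divisions by 2 below are exact, by the parity of n.
data I²ⁱ (n : ℕ) (α : ℂ) : Set where
  odd  : 2 ∤ n → (c : ℤ) →
         (+ ((n ℕ.∸ 1) ℕ./ 2)) ℤ.^ 2 ℤ.+ + 1 ℤ.≤ c →
         c ℤ.≤ (+ ((n ℕ.+ 1) ℕ./ 2)) ℤ.^ 2 →
         ¬ IsReal α →
         α ≈ ι ½ * (ι 1ℚ + √ (+ 1 ℤ.- + 4 ℤ.* c)) →
         I²ⁱ n α
  even : 2 ∣ n → (c : ℤ) →
         (+ (n ℕ./ 2)) ℤ.^ 2 ℤ.< c →
         c ℤ.< (+ (n ℕ./ 2) ℤ.+ + 1) ℤ.^ 2 →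
         ¬ IsReal α →
         α ≈ √ (ℤ.- c) →
         I²ⁱ n α

{-# OPTIONS --safe #-}

-- Every element of ℚ(√−c), or of ℚ(√(1−4c)), has the form p + q√C i with p, q rational and C = c,
-- respectively C = 4c − 1.  So if α and β generate the same field, then √D = k√C with k rational, and
-- CD = s² is a square of an integer.  For C < D the positive integer C + D − 2s = (√D − √C)² is then at
-- least 1, so D ≥ (√C + 1)², which is impossible for even n since √C and √D lie strictly between
-- consecutive integers.  For odd n the interval is twice as long, but C ≡ D ≡ 3 (mod 4) makes
-- C + D − 2s divisible by 4, so √D − √C ≥ 2.

module Submission where

open import Defs
open import Algebra.Properties.Group using (x∙y⁻¹≈ε⇒x≈y)
open import Data.Integer.Base as ℤ using (ℤ; +_; -[1+_])
import Data.Integer.Properties as ℤ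
open import Data.Nat.Base as ℕ using (ℕ; NonZero; zero; suc)
open import Data.Nat.Coprimality using (Coprime; coprime-divisor; recompute) renaming (sym to coprime-sym)
open import Data.Nat.Divisibility using (divides)
import Data.Nat.DivMod as ℕ
import Data.Nat.Properties as ℕ
open import Data.Nat.Tactic.RingSolver using (solve-∀)
open import Data.Product.Base using (∃; ∃₂; _×_; _,_; proj₁; proj₂)
open import Data.Rational.Base as ℚ using (ℚ; 0ℚ; 1ℚ; ½; mkℚ; ∣_∣; 1/_; toℚᵘ)
import Data.Rational.Properties as ℚ
open import Data.Rational.Solver using (module +-*-Solver)
import Data.Rational.Unnormalised.Base as ℚᵘ
import Data.Rational.Unnormalised.Properties as ℚᵘ
open import Data.Sum.Base using (_⊎_; inj₁; inj₂; reduce)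
open import Level using (0ℓ)
open import Relation.Binary.Bundles using (Setoid)
open import Relation.Binary.Definitions using (tri<; tri≈; tri>)
open import Relation.Binary.PropositionalEquality
import Relation.Binary.Reasoning.Setoid as SetoidReasoning
open import Relation.Nullary using (¬_; contradiction)
open import Relation.Unary using (Pred; _∈_; _⊆_; _≐_)

open +-*-Solver using (solve; con; _:=_; _:+_; _:*_; _:-_; :-_)

-- Natural numbers whose product is a square

square-cancel-≤ : ∀ {a b} → a ℕ.* a ℕ.≤ b ℕ.* b → a ℕ.≤ b
square-cancel-≤ {a} {b} a²≤b² = ℕ.≮⇒≥ λ b<a → ℕ.<⇒≱ (ℕ.*-mono-< b<a b<a) a²≤b²

square-cancel-< : ∀ {a b} → a ℕ.* a ℕ.< b ℕ.* b → a ℕ.< b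
square-cancel-< {a} {b} a²<b² = ℕ.≰⇒> λ b≤a → ℕ.<⇒≱ a²<b² (ℕ.*-mono-≤ b≤a b≤a)

even⊎odd : ∀ u → (∃ λ w → u ≡ 2 ℕ.* w) ⊎ (∃ λ w → u ≡ suc (2 ℕ.* w))
even⊎odd zero = inj₁ (0 , refl)
even⊎odd (suc u) with even⊎odd u
... | inj₁ (w , refl) = inj₂ (w , refl)
... | inj₂ (w , refl) = inj₁ (suc w , step w)
  where
  step : ∀ w → suc (suc (2 ℕ.* w)) ≡ 2 ℕ.* suc w
  step = solve-∀

-- y − x − 2u is (√y − √x)², where u = √(xy) − x.
square-product-gap : ∀ {x y s} .{{_ : NonZero x}} → x ℕ.< y → s ℕ.* s ≡ x ℕ.* y →
  ∃₂ λ u k → y ≡ x ℕ.+ 2 ℕ.* u ℕ.+ suc k × u ℕ.* u ≡ x ℕ.* suc k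
square-product-gap {x} {y} {s} x<y s²≡xy
  -- Since x² ≤ xy = s², also x ≤ s, so s = x + u; the next match writes y = x + v.
  with u , refl ← ℕ.m≤n⇒∃[o]m+o≡n (square-cancel-≤ {x} {s}
         (subst (x ℕ.* x ℕ.≤_) (sym s²≡xy) (ℕ.*-monoʳ-≤ x (ℕ.<⇒≤ x<y))))
  with v , refl ← ℕ.m≤n⇒∃[o]m+o≡n (ℕ.<⇒≤ x<y)
  -- Here x · 2u ≤ x · 2u + u² = xv, and cancelling x gives 2u ≤ v; the gap is k = v - 2u.
  = split (ℕ.m≤n⇒∃[o]m+o≡n (ℕ.*-cancelˡ-≤ x (subst (x ℕ.* (2 ℕ.* u) ℕ.≤_) xv (ℕ.m≤m+n _ (u ℕ.* u)))))
  where
  expand : ∀ x u → x ℕ.* x ℕ.+ (x ℕ.* (2 ℕ.* u) ℕ.+ u ℕ.* u) ≡ (x ℕ.+ u) ℕ.* (x ℕ.+ u)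
  expand = solve-∀
  xv : x ℕ.* (2 ℕ.* u) ℕ.+ u ℕ.* u ≡ x ℕ.* v
  xv = ℕ.+-cancelˡ-≡ (x ℕ.* x) _ _
    (trans (expand x u) (trans s²≡xy (ℕ.*-distribˡ-+ x x v)))
  split : ∃ (λ k → 2 ℕ.* u ℕ.+ k ≡ v) → ∃₂ λ u k → x ℕ.+ v ≡ x ℕ.+ 2 ℕ.* u ℕ.+ suc k × u ℕ.* u ≡ x ℕ.* suc k
  split (k , refl) with k | ℕ.+-cancelˡ-≡ (x ℕ.* (2 ℕ.* u)) (u ℕ.* u) (x ℕ.* k) (trans xv (ℕ.*-distribˡ-+ x (2 ℕ.* u) k))
  ... | suc k | u²≡ = u , k , sym (ℕ.+-assoc x (2 ℕ.* u) (suc k)) , u²≡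
  -- A zero gap gives u² = 0, so u = v = 0 and y = x.
  ... | zero  | u²≡ with refl ← reduce (ℕ.m*n≡0⇒m≡0∨n≡0 u (trans u²≡ (ℕ.*-zeroʳ x))) =
    contradiction x<y (ℕ.≤⇒≯ (ℕ.≤-reflexive (ℕ.+-identityʳ x)))

-- The gap k + 1 is at least 1, so u² = x(k + 1) ≥ x > m² and u > m. Then y = x + 2u + (k + 1) is at
-- least m² + 2m + 1, which is too large.
no-square-product-between-squares : ∀ {m x y s} → m ℕ.* m ℕ.< x → y ℕ.< suc m ℕ.* suc m →
  x ℕ.< y → s ℕ.* s ≢ x ℕ.* y
no-square-product-between-squares {m} {x@(suc _)} {y} {s} m²<x y<m₁² x<y s²≡xy =
  refute (square-product-gap {s = s} x<y s²≡xy)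
  where
  open ℕ.≤-Reasoning
  rearrange : ∀ m → suc m ℕ.* suc m ≡ m ℕ.* m ℕ.+ 2 ℕ.* m ℕ.+ 1
  rearrange = solve-∀
  refute : ¬ ∃₂ λ u k → y ≡ x ℕ.+ 2 ℕ.* u ℕ.+ suc k × u ℕ.* u ≡ x ℕ.* suc k
  refute (u , k , y≡ , u²≡) = ℕ.<⇒≱ y<m₁² (begin
    suc m ℕ.* suc m           ≡⟨ rearrange m ⟩
    m ℕ.* m ℕ.+ 2 ℕ.* m ℕ.+ 1 ≤⟨ ℕ.+-mono-≤ (ℕ.+-mono-≤ (ℕ.<⇒≤ m²<x) (ℕ.*-monoʳ-≤ 2 (ℕ.<⇒≤ m<u))) (ℕ.s≤s ℕ.z≤n) ⟩
    x ℕ.+ 2 ℕ.* u ℕ.+ suc k   ≡⟨ y≡ ⟨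
    y                         ∎)
    where
    m<u : m ℕ.< u
    m<u = square-cancel-< (begin-strict
      m ℕ.* m     <⟨ m²<x ⟩
      x           ≤⟨ ℕ.m≤m*n x (suc k) ⟩
      x ℕ.* suc k ≡⟨ u²≡ ⟨
      u ℕ.* u     ∎)

-- Below, suc k = (√y − √x)², which must be at least 4: it is even by parity, and 2 would make u² ≡ 2 (mod 4).
no-square-product-3+4c : ∀ {m c d s} → m ℕ.* m ℕ.≤ c → suc d ℕ.≤ suc m ℕ.* suc m →
  c ℕ.< d → s ℕ.* s ≢ (3 ℕ.+ 4 ℕ.* c) ℕ.* (3 ℕ.+ 4 ℕ.* d)
no-square-product-3+4c {m} {c} {d} {s} m²≤c d<m₁² c<d s²≡ =
  refute (square-product-gap {s = s} (ℕ.+-monoʳ-< 3 (ℕ.*-monoʳ-< 4 c<d)) s²≡)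
  where
  open ℕ.≤-Reasoning

  gap-not-odd : ∀ u j → 3 ℕ.+ 4 ℕ.* d ≢ 3 ℕ.+ 4 ℕ.* c ℕ.+ 2 ℕ.* u ℕ.+ suc (2 ℕ.* j)
  gap-not-odd u j eq = ℕ.even≢odd (2 ℕ.* c ℕ.+ u ℕ.+ j ℕ.+ 2) (2 ℕ.* d ℕ.+ 1)
    (trans (sym (rhs c u j)) (trans (sym eq) (lhs d)))
    where
    lhs : ∀ d → 3 ℕ.+ 4 ℕ.* d ≡ suc (2 ℕ.* (2 ℕ.* d ℕ.+ 1))
    lhs = solve-∀
    rhs : ∀ c u j → 3 ℕ.+ 4 ℕ.* c ℕ.+ 2 ℕ.* u ℕ.+ suc (2 ℕ.* j) ≡ 2 ℕ.* (2 ℕ.* c ℕ.+ u ℕ.+ j ℕ.+ 2)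
    rhs = solve-∀

  gap≢2 : ∀ u → u ℕ.* u ≢ (3 ℕ.+ 4 ℕ.* c) ℕ.* 2
  gap≢2 u eq with even⊎odd u
  ... | inj₁ (w , refl) = ℕ.even≢odd (w ℕ.* w) (1 ℕ.+ 2 ℕ.* c)
    (ℕ.*-cancelˡ-≡ _ _ 2 (trans (sym (lhs w)) (trans eq (rhs c))))
    where
    lhs : ∀ w → 2 ℕ.* w ℕ.* (2 ℕ.* w) ≡ 2 ℕ.* (2 ℕ.* (w ℕ.* w))
    lhs = solve-∀
    rhs : ∀ c → (3 ℕ.+ 4 ℕ.* c) ℕ.* 2 ≡ 2 ℕ.* suc (2 ℕ.* (1 ℕ.+ 2 ℕ.* c))
    rhs = solve-∀
  ... | inj₂ (w , refl) = ℕ.even≢odd (3 ℕ.+ 4 ℕ.* c) (2 ℕ.* (w ℕ.* w) ℕ.+ 2 ℕ.* w)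
    (trans (ℕ.*-comm 2 (3 ℕ.+ 4 ℕ.* c)) (trans (sym eq) (lhs w)))
    where
    lhs : ∀ w → suc (2 ℕ.* w) ℕ.* suc (2 ℕ.* w) ≡ suc (2 ℕ.* (2 ℕ.* (w ℕ.* w) ℕ.+ 2 ℕ.* w))
    lhs = solve-∀

  refute : ¬ ∃₂ λ u k → 3 ℕ.+ 4 ℕ.* d ≡ 3 ℕ.+ 4 ℕ.* c ℕ.+ 2 ℕ.* u ℕ.+ suc k × u ℕ.* u ≡ (3 ℕ.+ 4 ℕ.* c) ℕ.* suc k
  refute (u , 0 , gap , _)  = gap-not-odd u 0 gap
  refute (u , 1 , _ , u²≡)  = gap≢2 u u²≡
  refute (u , 2 , gap , _)  = gap-not-odd u 1 gap
  -- Now the gap is 4 + j, so u² = (3 + 4c)(4 + j) > 16m² and u ≥ 4m + 1. Hence 3 + 4d ≥ 3 + 4m² +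
  -- 2(4m + 1) + 4, which is 2 more than 3 + 4(m + 1)², and d ≥ (m + 1)².
  refute (u , suc (suc (suc j)) , gap , u²≡) =
    ℕ.<⇒≱ d<m₁² (ℕ.*-cancelˡ-≤ 4 (ℕ.+-cancelˡ-≤ 3 _ _ (begin
      3 ℕ.+ 4 ℕ.* (suc m ℕ.* suc m)
        ≤⟨ ℕ.m≤m+n _ 2 ⟩
      3 ℕ.+ 4 ℕ.* (suc m ℕ.* suc m) ℕ.+ 2
        ≡⟨ rearrange m ⟩
      3 ℕ.+ 4 ℕ.* (m ℕ.* m) ℕ.+ 2 ℕ.* suc (4 ℕ.* m) ℕ.+ 4
        ≤⟨ ℕ.+-mono-≤ (ℕ.+-mono-≤ (ℕ.+-monoʳ-≤ 3 (ℕ.*-monoʳ-≤ 4 m²≤c)) (ℕ.*-monoʳ-≤ 2 4m<u)) (ℕ.m≤m+n 4 j) ⟩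
      3 ℕ.+ 4 ℕ.* c ℕ.+ 2 ℕ.* u ℕ.+ (4 ℕ.+ j)
        ≡⟨ gap ⟨
      3 ℕ.+ 4 ℕ.* d ∎)))
    where
    rearrange : ∀ m → 3 ℕ.+ 4 ℕ.* (suc m ℕ.* suc m) ℕ.+ 2 ≡ 3 ℕ.+ 4 ℕ.* (m ℕ.* m) ℕ.+ 2 ℕ.* suc (4 ℕ.* m) ℕ.+ 4
    rearrange = solve-∀
    square-4m : ∀ m → 4 ℕ.* m ℕ.* (4 ℕ.* m) ≡ 4 ℕ.* (m ℕ.* m) ℕ.* 4
    square-4m = solve-∀
    4m<u : 4 ℕ.* m ℕ.< u
    4m<u = square-cancel-< (begin-strict
      4 ℕ.* m ℕ.* (4 ℕ.* m)         ≡⟨ square-4m m ⟩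
      4 ℕ.* (m ℕ.* m) ℕ.* 4         ≤⟨ ℕ.*-monoˡ-≤ 4 (ℕ.*-monoʳ-≤ 4 m²≤c) ⟩
      4 ℕ.* c ℕ.* 4                 <⟨ ℕ.*-monoˡ-< 4 (ℕ.m<n+m (4 ℕ.* c) {3} ℕ.z<s) ⟩
      (3 ℕ.+ 4 ℕ.* c) ℕ.* 4         ≤⟨ ℕ.*-monoʳ-≤ (3 ℕ.+ 4 ℕ.* c) (ℕ.m≤m+n 4 j) ⟩
      (3 ℕ.+ 4 ℕ.* c) ℕ.* (4 ℕ.+ j) ≡⟨ u²≡ ⟨
      u ℕ.* u                       ∎)

-- Null sequences and equality of reals

-- By unfolding, `x ≈ᴿ y` is `Null` of the termwise difference. Equations between reals can
-- therefore be combined linearly with `_⊕_`, `_⊖_` and `_⊛_`, and `null-resp` then reduces the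
-- claim to a polynomial identity in each term.
Null : (ℕ → ℚ) → Set
Null u = ∀ ε → 0ℚ ℚ.< ε → ∃ λ N → ∀ n → N ℕ.≤ n → ∣ u n ∣ ℚ.< ε

null-resp : ∀ {u v} → (∀ n → u n ≡ v n) → Null u → Null v
null-resp u≗v null ε 0<ε = let N , small = null ε 0<ε in
  N , λ n N≤n → subst (λ t → ∣ t ∣ ℚ.< ε) (u≗v n) (small n N≤n)

infixl 6 _⊕_ _⊖_
infixr 7 _⊛_

_⊕_ : ∀ {u v} → Null u → Null v → Null (λ n → u n ℚ.+ v n)
_⊕_ {u} {v} u-null v-null ε 0<ε =
  let δ = ½ ℚ.* ε
      0<δ = subst (ℚ._< δ) (ℚ.*-zeroʳ ½) (ℚ.*-monoʳ-<-pos ½ 0<ε)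
      M , u-small = u-null δ 0<δ
      N , v-small = v-null δ 0<δ
      open ℚ.≤-Reasoning
  in M ℕ.⊔ N , λ n ≤n → begin-strict
    ∣ u n ℚ.+ v n ∣
      ≤⟨ ℚ.∣p+q∣≤∣p∣+∣q∣ (u n) (v n) ⟩
    ∣ u n ∣ ℚ.+ ∣ v n ∣
      <⟨ ℚ.+-mono-< (u-small n (ℕ.m⊔n≤o⇒m≤o M N ≤n)) (v-small n (ℕ.m⊔n≤o⇒n≤o M N ≤n)) ⟩
    ½ ℚ.* ε ℚ.+ ½ ℚ.* ε
      ≡⟨ trans (sym (ℚ.*-distribʳ-+ ε ½ ½)) (ℚ.*-identityˡ ε) ⟩
    ε ∎

-- A Cauchy sequence is eventually bounded by some B > 0, so it suffices to wait until `u` stays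
-- below ε/B.
_⊛_ : ∀ a {u} → Null u → Null (λ n → seq a n ℚ.* u n)
_⊛_ a {u} null ε 0<ε = let B , 0<B , M , a-bound = eventually-bounded a in scaled B 0<B M a-bound
  where
  scaled : ∀ B → 0ℚ ℚ.< B → ∀ M → (∀ n → M ℕ.≤ n → ∣ seq a n ∣ ℚ.≤ B) →
    ∃ λ N → ∀ n → N ℕ.≤ n → ∣ seq a n ℚ.* u n ∣ ℚ.< ε
  scaled B 0<B M a-bound = M ℕ.⊔ N , λ n ≤n → begin-strict
    ∣ seq a n ℚ.* u n ∣       ≡⟨ ℚ.∣p*q∣≡∣p∣*∣q∣ (seq a n) (u n) ⟩
    ∣ seq a n ∣ ℚ.* ∣ u n ∣   ≤⟨ ℚ.*-monoʳ-≤-nonNeg ∣ u n ∣ {{ℚ.∣-∣-nonNeg (u n)}} (a-bound n (ℕ.m⊔n≤o⇒m≤o M N ≤n)) ⟩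
    B ℚ.* ∣ u n ∣             <⟨ ℚ.*-monoʳ-<-pos B (small n (ℕ.m⊔n≤o⇒n≤o M N ≤n)) ⟩
    B ℚ.* δ                   ≡⟨ ℚ.*-assoc B (1/ B) ε ⟨
    B ℚ.* 1/ B ℚ.* ε          ≡⟨ cong (ℚ._* ε) (ℚ.*-inverseʳ B) ⟩
    1ℚ ℚ.* ε                  ≡⟨ ℚ.*-identityˡ ε ⟩
    ε                         ∎
    where
    open ℚ.≤-Reasoning
    instance
      B>0 : ℚ.Positive B
      B>0 = ℚ.positive 0<B
      B≢0 : ℚ.NonZero B
      B≢0 = ℚ.pos⇒nonZero B
    δ : ℚ
    δ = 1/ B ℚ.* ε
    0<δ : 0ℚ ℚ.< δ
    0<δ = ℚ.positive⁻¹ δ {{ℚ.pos*pos⇒pos (1/ B) {{ℚ.1/pos⇒pos B}} ε {{ℚ.positive 0<ε}}}}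
    N = proj₁ (null δ 0<δ)
    small = proj₂ (null δ 0<δ)

_⊖_ : ∀ {u v} → Null u → Null v → Null (λ n → u n ℚ.- v n)
_⊖_ {u} {v} u-null v-null = null-resp
  (λ n → cong (u n ℚ.+_) (trans (sym (ℚ.neg-distribˡ-* 1ℚ (v n))) (cong ℚ.-_ (ℚ.*-identityˡ (v n)))))
  (u-null ⊕ fromℚ (ℚ.- 1ℚ) ⊛ v-null)

≗⇒≈ᴿ : ∀ {x y} → (∀ n → seq x n ≡ seq y n) → x ≈ᴿ y
≗⇒≈ᴿ {x} {y} x≗y ε 0<ε = 0 , λ n _ → subst (ℚ._< ε)
  (sym (cong ∣_∣ (trans (cong (ℚ._- seq y n) (x≗y n)) (ℚ.+-inverseʳ (seq y n))))) 0<ε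

≈ᴿ-refl : ∀ {x} → x ≈ᴿ x
≈ᴿ-refl {x} = ≗⇒≈ᴿ {x} {x} λ _ → refl

≈ᴿ-sym : ∀ {x y} → x ≈ᴿ y → y ≈ᴿ x
≈ᴿ-sym {x} {y} x≈y = null-resp
  (λ n → solve 2 (λ x y → con (ℚ.- 1ℚ) :* (x :- y) := y :- x) refl (seq x n) (seq y n))
  (fromℚ (ℚ.- 1ℚ) ⊛ x≈y)

≈ᴿ-trans : ∀ {x y z} → x ≈ᴿ y → y ≈ᴿ z → x ≈ᴿ z
≈ᴿ-trans {x} {y} {z} x≈y y≈z = null-resp
  (λ n → solve 3 (λ x y z → (x :- y) :+ (y :- z) := x :- z) refl (seq x n) (seq y n) (seq z n))
  (x≈y ⊕ y≈z)

+ᴿ-cong : ∀ {x x′ y y′} → x ≈ᴿ x′ → y ≈ᴿ y′ → x +ᴿ y ≈ᴿ x′ +ᴿ y′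
+ᴿ-cong {x} {x′} {y} {y′} x≈ y≈ = null-resp
  (λ n → solve 4 (λ x x′ y y′ → (x :- x′) :+ (y :- y′) := (x :+ y) :- (x′ :+ y′))
    refl (seq x n) (seq x′ n) (seq y n) (seq y′ n))
  (x≈ ⊕ y≈)

-ᴿ-cong : ∀ {x y} → x ≈ᴿ y → -ᴿ x ≈ᴿ -ᴿ y
-ᴿ-cong {x} {y} x≈y = null-resp
  (λ n → solve 2 (λ x y → con (ℚ.- 1ℚ) :* (x :- y) := :- x :- :- y) refl (seq x n) (seq y n))
  (fromℚ (ℚ.- 1ℚ) ⊛ x≈y)

*ᴿ-cong : ∀ {x x′ y y′} → x ≈ᴿ x′ → y ≈ᴿ y′ → x *ᴿ y ≈ᴿ x′ *ᴿ y′
*ᴿ-cong {x} {x′} {y} {y′} x≈ y≈ = null-resp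
  (λ n → solve 4 (λ x x′ y y′ → y :* (x :- x′) :+ x′ :* (y :- y′) := x :* y :- x′ :* y′)
    refl (seq x n) (seq x′ n) (seq y n) (seq y′ n))
  (y ⊛ x≈ ⊕ x′ ⊛ y≈)

≈ᴿ-setoid : Setoid 0ℓ 0ℓ
≈ᴿ-setoid = record { Carrier = ℝ ; _≈_ = _≈ᴿ_ ; isEquivalence = record
  { refl = λ {x} → ≈ᴿ-refl {x}
  ; sym = λ {x} {y} → ≈ᴿ-sym {x} {y}
  ; trans = λ {x} {y} {z} → ≈ᴿ-trans {x} {y} {z} } }

-- If p and q differed, taking ε = |p - q| would yield |p - q| < |p - q|. This brings equations
-- between limits back to exact rational ones.
fromℚ-injective : ∀ {p q} → fromℚ p ≈ᴿ fromℚ q → p ≡ q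
fromℚ-injective {p} {q} p≈q =
  x∙y⁻¹≈ε⇒x≈y ℚ.+-0-group p q (ℚ.∣p∣≡0⇒p≡0 (p ℚ.- q) (ℚ.≤-antisym (ℚ.≮⇒≥ not-small) (ℚ.0≤∣p∣ (p ℚ.- q))))
  where
  not-small : ¬ 0ℚ ℚ.< ∣ p ℚ.- q ∣
  not-small 0<gap = let N , small = p≈q ∣ p ℚ.- q ∣ 0<gap in ℚ.<-irrefl refl (small N ℕ.≤-refl)

divide : ∀ p .{{_ : ℚ.NonZero p}} x y → fromℚ p *ᴿ x ≈ᴿ y → x ≈ᴿ fromℚ (1/ p) *ᴿ y
divide p x y px≈y = begin
  x                                 ≈⟨ ≗⇒≈ᴿ {x} {fromℚ (1/ p) *ᴿ (fromℚ p *ᴿ x)} (λ n → sym (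
                                         trans (sym (ℚ.*-assoc (1/ p) p (seq x n)))
                                        (trans (cong (ℚ._* seq x n) (ℚ.*-inverseˡ p)) (ℚ.*-identityˡ (seq x n))))) ⟩
  fromℚ (1/ p) *ᴿ (fromℚ p *ᴿ x)    ≈⟨ *ᴿ-cong {fromℚ (1/ p)} {fromℚ (1/ p)} {fromℚ p *ᴿ x} {y} (≈ᴿ-refl {fromℚ (1/ p)}) px≈y ⟩
  fromℚ (1/ p) *ᴿ y                 ∎
  where open SetoidReasoning ≈ᴿ-setoid

-- The quadratic field of the numbers p + q r i with r² = C

module _ (r : ℝ) (C : ℚ) (r²≈C : r *ᴿ r ≈ᴿ fromℚ C) where

  -- This is ℚ(√-C) in explicit coordinates over the basis 1, r i. The lemmas that follow match the
  -- constructors of `ℚ⟨_⟩` one by one.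
  Quadratic : Pred ℂ 0ℓ
  Quadratic z = ∃₂ λ p q → re z ≈ᴿ fromℚ p × im z ≈ᴿ fromℚ q *ᴿ r

  quadratic-1 : ι 1ℚ ∈ Quadratic
  quadratic-1 = 1ℚ , 0ℚ , ≈ᴿ-refl {fromℚ 1ℚ} ,
    ≗⇒≈ᴿ {fromℚ 0ℚ} {fromℚ 0ℚ *ᴿ r} (λ n → sym (ℚ.*-zeroˡ (seq r n)))

  quadratic-≈ : ∀ {z w} → z ≈ w → z ∈ Quadratic → w ∈ Quadratic
  quadratic-≈ {z} {w} (re≈ , im≈) (p , q , re-z , im-z) = p , q ,
    ≈ᴿ-trans {re w} {re z} {fromℚ p} (≈ᴿ-sym {re z} {re w} re≈) re-z ,
    ≈ᴿ-trans {im w} {im z} {fromℚ q *ᴿ r} (≈ᴿ-sym {im z} {im w} im≈) im-z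

  quadratic-+ : ∀ {z w} → z ∈ Quadratic → w ∈ Quadratic → z + w ∈ Quadratic
  quadratic-+ {z} {w} (p , q , re-z , im-z) (p′ , q′ , re-w , im-w) = p ℚ.+ p′ , q ℚ.+ q′ ,
    +ᴿ-cong {re z} {fromℚ p} {re w} {fromℚ p′} re-z re-w ,
    null-resp (λ n → solve 5 (λ y y′ q q′ r → (y :- q :* r) :+ (y′ :- q′ :* r) := y :+ y′ :- (q :+ q′) :* r)
                 refl (seq (im z) n) (seq (im w) n) q q′ (seq r n))
      (im-z ⊕ im-w)

  quadratic-neg : ∀ {z} → z ∈ Quadratic → - z ∈ Quadratic
  quadratic-neg {z} (p , q , re-z , im-z) = ℚ.- p , ℚ.- q ,
    -ᴿ-cong {re z} {fromℚ p} re-z ,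
    null-resp (λ n → solve 3 (λ y q r → con (ℚ.- 1ℚ) :* (y :- q :* r) := :- y :- (:- q) :* r)
                 refl (seq (im z) n) q (seq r n))
      (fromℚ (ℚ.- 1ℚ) ⊛ im-z)

  quadratic-* : ∀ {z w} → z ∈ Quadratic → w ∈ Quadratic → z * w ∈ Quadratic
  quadratic-* {z} {w} (p , q , re-z , im-z) (p′ , q′ , re-w , im-w) =
    p ℚ.* p′ ℚ.- q ℚ.* q′ ℚ.* C , p ℚ.* q′ ℚ.+ q ℚ.* p′ ,
    -- The error of a product is a combination of the errors of its factors; the term with r² - C
    -- replaces r² by C.
    null-resp
      (λ n → solve 10 (λ x y x′ y′ p q p′ q′ r C →
          x′ :* (x :- p) :+ p :* (x′ :- p′)
            :- (y′ :* (y :- q :* r) :+ q :* r :* (y′ :- q′ :* r))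
            :- q :* q′ :* (r :* r :- C)
          := x :* x′ :- y :* y′ :- (p :* p′ :- q :* q′ :* C))
        refl (seq (re z) n) (seq (im z) n) (seq (re w) n) (seq (im w) n) p q p′ q′ (seq r n) C)
      (re w ⊛ re-z ⊕ fromℚ p ⊛ re-w
        ⊖ (im w ⊛ im-z ⊕ (fromℚ q *ᴿ r) ⊛ im-w)
        ⊖ fromℚ (q ℚ.* q′) ⊛ r²≈C) ,
    null-resp
      (λ n → solve 9 (λ x y x′ y′ p q p′ q′ r →
          y′ :* (x :- p) :+ p :* (y′ :- q′ :* r) :+ x′ :* (y :- q :* r) :+ q :* r :* (x′ :- p′)
          := x :* y′ :+ y :* x′ :- (p :* q′ :+ q :* p′) :* r)
        refl (seq (re z) n) (seq (im z) n) (seq (re w) n) (seq (im w) n) p q p′ q′ (seq r n))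
      (im w ⊛ re-z ⊕ fromℚ p ⊛ im-w ⊕ re w ⊛ im-z ⊕ (fromℚ q *ᴿ r) ⊛ re-w)

  -- Multiplying z w = 1 by the conjugate p - q r i shows that w is this conjugate divided by the
  -- norm p² + q²C. That the norm is nonzero has to be deduced from the existence of w.
  quadratic-⁻¹ : ∀ {z w} → z ∈ Quadratic → z * w ≈ ι 1ℚ → w ∈ Quadratic
  quadratic-⁻¹ {z} {w} (p , q , re-z , im-z) (re≈1 , im≈0) = result
    where
    x y s : ℝ
    x = re w
    y = im w
    s = fromℚ q *ᴿ r

    -- N = |z|², and norm-re and norm-im together say that N w is the conjugate of z.
    N : ℚ
    N = p ℚ.* p ℚ.+ q ℚ.* q ℚ.* C

    re-eq : fromℚ p *ᴿ x +ᴿ -ᴿ (s *ᴿ y) ≈ᴿ fromℚ 1ℚ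
    re-eq = null-resp
      (λ n → solve 6 (λ X Y x y p s →
          (X :* x :- Y :* y :- con 1ℚ) :- (x :* (X :- p) :- y :* (Y :- s))
          := p :* x :- s :* y :- con 1ℚ)
        refl (seq (re z) n) (seq (im z) n) (seq x n) (seq y n) p (seq s n))
      (re≈1 ⊖ (x ⊛ re-z ⊖ y ⊛ im-z))

    im-eq : fromℚ p *ᴿ y +ᴿ s *ᴿ x ≈ᴿ fromℚ 0ℚ
    im-eq = null-resp
      (λ n → solve 6 (λ X Y x y p s →
          (X :* y :+ Y :* x :- con 0ℚ) :- (y :* (X :- p) :+ x :* (Y :- s))
          := p :* y :+ s :* x :- con 0ℚ)
        refl (seq (re z) n) (seq (im z) n) (seq x n) (seq y n) p (seq s n))
      (im≈0 ⊖ (y ⊛ re-z ⊕ x ⊛ im-z))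

    -- With s = q r, the combination p · `re-eq` + s · `im-eq` has x-coefficient p² + s², and its
    -- terms in y cancel.
    norm-re : fromℚ N *ᴿ x ≈ᴿ fromℚ p
    norm-re = null-resp
      (λ n → solve 6 (λ x y p q r C →
          p :* (p :* x :- q :* r :* y :- con 1ℚ) :+ q :* r :* (p :* y :+ q :* r :* x :- con 0ℚ)
            :- q :* q :* x :* (r :* r :- C)
          := (p :* p :+ q :* q :* C) :* x :- p)
        refl (seq x n) (seq y n) p q (seq r n) C)
      (fromℚ p ⊛ re-eq ⊕ s ⊛ im-eq ⊖ (fromℚ (q ℚ.* q) *ᴿ x) ⊛ r²≈C)

    norm-im : fromℚ N *ᴿ y ≈ᴿ fromℚ (ℚ.- q) *ᴿ r
    norm-im = null-resp
      (λ n → solve 6 (λ x y p q r C →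
          p :* (p :* y :+ q :* r :* x :- con 0ℚ) :- q :* r :* (p :* x :- q :* r :* y :- con 1ℚ)
            :- q :* q :* y :* (r :* r :- C)
          := (p :* p :+ q :* q :* C) :* y :- (:- q) :* r)
        refl (seq x n) (seq y n) p q (seq r n) C)
      (fromℚ p ⊛ im-eq ⊖ s ⊛ re-eq ⊖ (fromℚ (q ℚ.* q) *ᴿ y) ⊛ r²≈C)

    -- That is, |z|²|w|² = 1, so N = 0 would force 0 = 1.
    norm-abs : fromℚ N *ᴿ (x *ᴿ x +ᴿ y *ᴿ y) ≈ᴿ fromℚ 1ℚ
    norm-abs = null-resp
      (λ n → solve 6 (λ x y p q r N →
          x :* (N :* x :- p) :+ y :* (N :* y :- (:- q) :* r) :+ (p :* x :- q :* r :* y :- con 1ℚ)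
          := N :* (x :* x :+ y :* y) :- con 1ℚ)
        refl (seq x n) (seq y n) p q (seq r n) N)
      (x ⊛ norm-re ⊕ y ⊛ norm-im ⊕ re-eq)

    norm≢0 : N ≢ 0ℚ
    norm≢0 N≡0 = contradiction (fromℚ-injective {0ℚ} {1ℚ} 0≈1) λ ()
      where
      0≈1 : fromℚ 0ℚ ≈ᴿ fromℚ 1ℚ
      0≈1 = null-resp
        (λ n → cong (ℚ._- 1ℚ) (trans (cong (ℚ._* ∣w∣² n) N≡0) (ℚ.*-zeroˡ (∣w∣² n))))
        norm-abs
        where
        ∣w∣² = seq (x *ᴿ x +ᴿ y *ᴿ y)

    result : w ∈ Quadratic
    result = 1/ N ℚ.* p , 1/ N ℚ.* (ℚ.- q) , re-w , im-w
      where
      instance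
        N≢0 = ℚ.≢-nonZero norm≢0
      re-w : x ≈ᴿ fromℚ (1/ N ℚ.* p)
      re-w = divide N x (fromℚ p) norm-re
      im-w : y ≈ᴿ fromℚ (1/ N ℚ.* (ℚ.- q)) *ᴿ r
      im-w = null-resp (λ n → cong (λ t → seq y n ℚ.- t) (sym (ℚ.*-assoc (1/ N) (ℚ.- q) (seq r n))))
        (divide N y (fromℚ (ℚ.- q) *ᴿ r) norm-im)

  -- Induction on the derivation of membership: a subfield containing α contains all of ℚ(α).
  ℚ⟨⟩⊆quadratic : ∀ {α} → α ∈ Quadratic → ℚ⟨ α ⟩ ⊆ Quadratic
  ℚ⟨⟩⊆quadratic α∈ generator = α∈
  ℚ⟨⟩⊆quadratic α∈ 1-closed = quadratic-1
  ℚ⟨⟩⊆quadratic α∈ (+-closed {z} {w} z∈ w∈) = quadratic-+ {z} {w} (ℚ⟨⟩⊆quadratic α∈ z∈) (ℚ⟨⟩⊆quadratic α∈ w∈)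
  ℚ⟨⟩⊆quadratic α∈ (neg-closed {z} z∈) = quadratic-neg {z} (ℚ⟨⟩⊆quadratic α∈ z∈)
  ℚ⟨⟩⊆quadratic α∈ (*-closed {z} {w} z∈ w∈) = quadratic-* {z} {w} (ℚ⟨⟩⊆quadratic α∈ z∈) (ℚ⟨⟩⊆quadratic α∈ w∈)
  ℚ⟨⟩⊆quadratic α∈ (⁻¹-closed {z} {w} z∈ zw≈1) = quadratic-⁻¹ {z} {w} (ℚ⟨⟩⊆quadratic α∈ z∈) zw≈1
  ℚ⟨⟩⊆quadratic α∈ (≈-closed {z} {w} z≈w z∈) = quadratic-≈ {z} {w} z≈w (ℚ⟨⟩⊆quadratic α∈ z∈)

-- From a rational ratio of square roots to a square product

-- Here d/c = (a/b)² in lowest terms, so the root of cd is c · a/b. It is an integer because b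
-- divides c; with c = e b it equals a e.
coprime-square-ratio : ∀ {a b c d} .{{_ : NonZero b}} → Coprime b a →
  d ℕ.* (b ℕ.* b) ≡ a ℕ.* a ℕ.* c → ∃ λ s → s ℕ.* s ≡ c ℕ.* d
coprime-square-ratio {a} {b} {c} {d} b⊥a eq
  -- From b ∣ a(a c), coprimality strips the two factors a one after the other.
  with divides e refl ← coprime-divisor {o = c} b⊥a (coprime-divisor b⊥a
         (divides (d ℕ.* b) (trans (sym (ℕ.*-assoc a a c)) (trans (sym eq) (sym (ℕ.*-assoc d b b))))))
  = a ℕ.* e , (begin
    a ℕ.* e ℕ.* (a ℕ.* e)     ≡⟨ regroup a e ⟩
    a ℕ.* a ℕ.* e ℕ.* e       ≡⟨ cong (ℕ._* e) (ℕ.*-cancelʳ-≡ (a ℕ.* a ℕ.* e) (d ℕ.* b) b (begin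
      a ℕ.* a ℕ.* e ℕ.* b         ≡⟨ ℕ.*-assoc (a ℕ.* a) e b ⟩
      a ℕ.* a ℕ.* (e ℕ.* b)       ≡⟨ eq ⟨
      d ℕ.* (b ℕ.* b)             ≡⟨ ℕ.*-assoc d b b ⟨
      d ℕ.* b ℕ.* b               ∎)) ⟩
    d ℕ.* b ℕ.* e             ≡⟨ rotate d b e ⟩
    e ℕ.* b ℕ.* d             ∎)
  where
  open ≡-Reasoning
  regroup : ∀ a e → a ℕ.* e ℕ.* (a ℕ.* e) ≡ a ℕ.* a ℕ.* e ℕ.* e
  regroup = solve-∀
  rotate : ∀ d b e → d ℕ.* b ℕ.* e ≡ e ℕ.* b ℕ.* d
  rotate = solve-∀

-- For unnormalised fractions `≃` is literally a cross-multiplication in ℤ. Absolute values carry it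
-- to ℕ, and the sign of k is lost harmlessly because k occurs squared.
≃-clear-denominators : ∀ k c d → ℚᵘ.mkℚᵘ (+ d) 0 ℚᵘ.≃ k ℚᵘ.* k ℚᵘ.* ℚᵘ.mkℚᵘ (+ c) 0 →
  d ℕ.* (ℚᵘ.↧ₙ k ℕ.* ℚᵘ.↧ₙ k) ≡ ℤ.∣ ℚᵘ.↥ k ∣ ℕ.* ℤ.∣ ℚᵘ.↥ k ∣ ℕ.* c
≃-clear-denominators (ℚᵘ.mkℚᵘ a b-1) c d (ℚᵘ.*≡* eq) = begin
  d ℕ.* (b ℕ.* b)                     ≡⟨ cong (d ℕ.*_) (ℕ.*-identityʳ (b ℕ.* b)) ⟨
  d ℕ.* (b ℕ.* b ℕ.* 1)               ≡⟨ ℤ.abs-* (+ d) (+ (b ℕ.* b ℕ.* 1)) ⟨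
  ℤ.∣ + d ℤ.* + (b ℕ.* b ℕ.* 1) ∣     ≡⟨ cong ℤ.∣_∣ eq ⟩
  ℤ.∣ a ℤ.* a ℤ.* + c ℤ.* + 1 ∣       ≡⟨ cong ℤ.∣_∣ (ℤ.*-identityʳ (a ℤ.* a ℤ.* + c)) ⟩
  ℤ.∣ a ℤ.* a ℤ.* + c ∣               ≡⟨ ℤ.abs-* (a ℤ.* a) (+ c) ⟩
  ℤ.∣ a ℤ.* a ∣ ℕ.* c                 ≡⟨ cong (ℕ._* c) (ℤ.abs-* a a) ⟩
  ℤ.∣ a ∣ ℕ.* ℤ.∣ a ∣ ℕ.* c           ∎
  where
  open ≡-Reasoning
  b = suc b-1

coprime-↧-↥ : ∀ k → Coprime (ℚᵘ.↧ₙ (toℚᵘ k)) ℤ.∣ ℚᵘ.↥ (toℚᵘ k) ∣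
coprime-↧-↥ (mkℚ _ _ coprime) = coprime-sym (recompute coprime)

rational-square-ratio : ∀ k c d → + d ℚ./ 1 ≡ k ℚ.* k ℚ.* (+ c ℚ./ 1) → ∃ λ s → s ℕ.* s ≡ c ℕ.* d
rational-square-ratio k c d eq =
  coprime-square-ratio {c = c} {d} (coprime-↧-↥ k) (≃-clear-denominators (toℚᵘ k) c d fractions)
  where
  open SetoidReasoning ℚᵘ.≃-setoid
  fractions : ℚᵘ.mkℚᵘ (+ d) 0 ℚᵘ.≃ toℚᵘ k ℚᵘ.* toℚᵘ k ℚᵘ.* ℚᵘ.mkℚᵘ (+ c) 0
  fractions = begin
    ℚᵘ.mkℚᵘ (+ d) 0                             ≈⟨ ℚ.toℚᵘ-fromℚᵘ (ℚᵘ.mkℚᵘ (+ d) 0) ⟨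
    toℚᵘ (+ d ℚ./ 1)                            ≡⟨ cong toℚᵘ eq ⟩
    toℚᵘ (k ℚ.* k ℚ.* (+ c ℚ./ 1))              ≈⟨ ℚ.toℚᵘ-homo-* (k ℚ.* k) (+ c ℚ./ 1) ⟩
    toℚᵘ (k ℚ.* k) ℚᵘ.* toℚᵘ (+ c ℚ./ 1)        ≈⟨ ℚᵘ.*-cong (ℚ.toℚᵘ-homo-* k k) (ℚ.toℚᵘ-fromℚᵘ (ℚᵘ.mkℚᵘ (+ c) 0)) ⟩
    toℚᵘ k ℚᵘ.* toℚᵘ k ℚᵘ.* ℚᵘ.mkℚᵘ (+ c) 0     ∎

-- Squaring removes both roots and leaves d = k²c between constant sequences, hence between
-- rationals.
√-ratio : ∀ k c d → √ᴿ d ≈ᴿ fromℚ k *ᴿ √ᴿ c → ∃ λ s → s ℕ.* s ≡ c ℕ.* d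
√-ratio k c d √d≈ = rational-square-ratio k c d (fromℚ-injective (begin
  fromℚ (+ d ℚ./ 1)                       ≈⟨ √ᴿ-square d ⟨
  √ᴿ d *ᴿ √ᴿ d                            ≈⟨ *ᴿ-cong {√ᴿ d} {fromℚ k *ᴿ √ᴿ c} {√ᴿ d} {fromℚ k *ᴿ √ᴿ c} √d≈ √d≈ ⟩
  (fromℚ k *ᴿ √ᴿ c) *ᴿ (fromℚ k *ᴿ √ᴿ c)  ≈⟨ ≗⇒≈ᴿ {(fromℚ k *ᴿ √ᴿ c) *ᴿ (fromℚ k *ᴿ √ᴿ c)} {fromℚ (k ℚ.* k) *ᴿ (√ᴿ c *ᴿ √ᴿ c)} (λ n →
                                               solve 2 (λ k r → k :* r :* (k :* r) := k :* k :* (r :* r)) refl k (seq (√ᴿ c) n)) ⟩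
  fromℚ (k ℚ.* k) *ᴿ (√ᴿ c *ᴿ √ᴿ c)       ≈⟨ *ᴿ-cong {fromℚ (k ℚ.* k)} {fromℚ (k ℚ.* k)} {√ᴿ c *ᴿ √ᴿ c} {fromℚ (+ c ℚ./ 1)} (≈ᴿ-refl {fromℚ (k ℚ.* k)}) (√ᴿ-square c) ⟩
  fromℚ (k ℚ.* k ℚ.* (+ c ℚ./ 1))         ∎))
  where open SetoidReasoning ≈ᴿ-setoid

-- Comparing the fields of two numbers of the same shape

-- All members of one interval share p and q: these are 0 and 1 for even n, ½ and ½ for odd n. Only
-- the radicand varies.
Form : ℚ → ℚ → ℕ → Pred ℂ 0ℓ
Form p q c z = re z ≈ᴿ fromℚ p × im z ≈ᴿ fromℚ q *ᴿ √ᴿ c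

form-unique : ∀ {p q c z w} → z ∈ Form p q c → w ∈ Form p q c → z ≈ w
form-unique {p} {q} {c} {z} {w} (re-z , im-z) (re-w , im-w) =
  ≈ᴿ-trans {re z} {fromℚ p} {re w} re-z (≈ᴿ-sym {re w} {fromℚ p} re-w) ,
  ≈ᴿ-trans {im z} {fromℚ q *ᴿ √ᴿ c} {im w} im-z (≈ᴿ-sym {im w} {fromℚ q *ᴿ √ᴿ c} im-w)

-- Membership in ℚ(α) gives β an imaginary part k√c, while its form gives q√d; dividing by q makes
-- √d a rational multiple of √c.
form-∈ℚ⟨⟩ : ∀ {p q c d α β} .{{_ : ℚ.NonZero q}} → α ∈ Form p q c → β ∈ Form p q d →
  β ∈ ℚ⟨ α ⟩ → ∃ λ s → s ℕ.* s ≡ c ℕ.* d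
form-∈ℚ⟨⟩ {p} {q} {c} {d} {α} {β} (re-α , im-α) (_ , im-β) β∈ =
  ratio (ℚ⟨⟩⊆quadratic (√ᴿ c) (+ c ℚ./ 1) (√ᴿ-square c) {α} (p , q , re-α , im-α) β∈)
  where
  open SetoidReasoning ≈ᴿ-setoid
  ratio : β ∈ Quadratic (√ᴿ c) (+ c ℚ./ 1) (√ᴿ-square c) → ∃ λ s → s ℕ.* s ≡ c ℕ.* d
  ratio (_ , k , _ , im-β′) = √-ratio (1/ q ℚ.* k) c d (begin
    √ᴿ d
      ≈⟨ divide q (√ᴿ d) (fromℚ k *ᴿ √ᴿ c)
           (≈ᴿ-trans {fromℚ q *ᴿ √ᴿ d} {im β} {fromℚ k *ᴿ √ᴿ c} (≈ᴿ-sym {im β} {fromℚ q *ᴿ √ᴿ d} im-β) im-β′) ⟩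
    fromℚ (1/ q) *ᴿ (fromℚ k *ᴿ √ᴿ c)
      ≈⟨ ≗⇒≈ᴿ {fromℚ (1/ q) *ᴿ (fromℚ k *ᴿ √ᴿ c)} {fromℚ (1/ q ℚ.* k) *ᴿ √ᴿ c}
           (λ n → sym (ℚ.*-assoc (1/ q) k (seq (√ᴿ c) n))) ⟩
    fromℚ (1/ q ℚ.* k) *ᴿ √ᴿ c ∎)

-- Equal indices would give α ≈ β. Otherwise the generator with the larger index is viewed inside
-- the field of the other, so that `no-square` is needed for c < d alone. `f` sends an index to its
-- radicand.
fields-differ : ∀ {p q} .{{_ : ℚ.NonZero q}} (P : Pred ℕ 0ℓ) (f : ℕ → ℕ) →
  (∀ {c d s} → P c → P d → c ℕ.< d → s ℕ.* s ≢ f c ℕ.* f d) →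
  ∀ {c d α β} → P c → P d → α ∈ Form p q (f c) → β ∈ Form p q (f d) →
  α ≉ β → ¬ (ℚ⟨ α ⟩ ≐ ℚ⟨ β ⟩)
fields-differ {p} {q} P f no-square {c} {d} {α} {β} Pc Pd α-form β-form α≉β (⊆ , ⊇) with ℕ.<-cmp c d
... | tri≈ _ refl _ = α≉β (form-unique {p} {q} {f c} {α} {β} α-form β-form)
... | tri< c<d _ _ = let s , s²≡ = form-∈ℚ⟨⟩ {p} {q} {f c} {f d} {α} {β} α-form β-form (⊇ generator)
                     in no-square {s = s} Pc Pd c<d s²≡
... | tri> _ _ d<c = let s , s²≡ = form-∈ℚ⟨⟩ {p} {q} {f d} {f c} {β} {α} β-form α-form (⊆ generator)
                     in no-square {s = s} Pd Pc d<c s²≡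

-- Bounds and coordinates for the members of the intervals

^2≡ : ∀ a → (+ a) ℤ.^ 2 ≡ + (a ℕ.* a)
^2≡ a = trans (cong (+ a ℤ.*_) (ℤ.*-identityʳ (+ a))) (sym (ℤ.pos-* a a))

-- The integer c of the theorem is suc c here.
OddRange EvenRange : ℕ → Pred ℕ 0ℓ
OddRange m c = m ℕ.* m ℕ.≤ c × suc c ℕ.≤ suc m ℕ.* suc m
EvenRange m c = m ℕ.* m ℕ.< suc c × suc c ℕ.< suc m ℕ.* suc m

-- The lower bound forces c to be positive; once c is a visible successor, the radicand is a
-- negative literal and `√` computes to its imaginary branch.
odd-range : ∀ {m c} → (+ m) ℤ.^ 2 ℤ.+ + 1 ℤ.≤ c → c ℤ.≤ (+ suc m) ℤ.^ 2 →
  ∃ λ c′ → c ≡ + suc c′ × c′ ∈ OddRange m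
odd-range {m} {c} lower upper =
  go c (subst (ℤ._≤ c) (trans (cong (ℤ._+ + 1) (^2≡ m)) (cong +_ (ℕ.+-comm (m ℕ.* m) 1))) lower)
       (subst (c ℤ.≤_) (^2≡ (suc m)) upper)
  where
  go : ∀ c → + suc (m ℕ.* m) ℤ.≤ c → c ℤ.≤ + (suc m ℕ.* suc m) →
    ∃ λ c′ → c ≡ + suc c′ × c′ ∈ OddRange m
  go (+ suc c′) (ℤ.+≤+ (ℕ.s≤s lower)) (ℤ.+≤+ upper) = c′ , refl , lower , upper

even-range : ∀ {m c} → (+ m) ℤ.^ 2 ℤ.< c → c ℤ.< (+ m ℤ.+ + 1) ℤ.^ 2 →
  ∃ λ c′ → c ≡ + suc c′ × c′ ∈ EvenRange m
even-range {m} {c} lower upper =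
  go c (subst (ℤ._< c) (^2≡ m) lower)
       (subst (c ℤ.<_) (trans (cong (λ t → (+ t) ℤ.^ 2) (ℕ.+-comm m 1)) (^2≡ (suc m))) upper)
  where
  go : ∀ c → + (m ℕ.* m) ℤ.< c → c ℤ.< + (suc m ℕ.* suc m) →
    ∃ λ c′ → c ≡ + suc c′ × c′ ∈ EvenRange m
  go (+ zero)   (ℤ.+<+ ()) _
  go (+ suc c′) (ℤ.+<+ lower) (ℤ.+<+ upper) = c′ , refl , lower , upper

even-form : ∀ {α} c → α ≈ √ (ℤ.- (+ suc c)) → α ∈ Form 0ℚ 1ℚ (suc c)
even-form {α} c (re-α , im-α) = re-α ,
  null-resp (λ n → cong (λ t → seq (im α) n ℚ.- t) (sym (ℚ.*-identityˡ (seq (√ᴿ (suc c)) n)))) im-α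

-- The radicand 3 + 4c comes from 1 - 4(c + 1) = -(3 + 4c).
odd-discriminant : ∀ c → + 1 ℤ.- + 4 ℤ.* + suc c ≡ -[1+ (2 ℕ.+ 4 ℕ.* c) ]
odd-discriminant c = cong (λ t → + 1 ℤ.- + t) (ℕ.*-suc 4 c)

odd-form : ∀ {α} c → α ≈ ι ½ * (ι 1ℚ + √ (+ 1 ℤ.- + 4 ℤ.* + suc c)) → α ∈ Form ½ ½ (3 ℕ.+ 4 ℕ.* c)
odd-form {α} c α≈ = components (subst (λ t → α ≈ ι ½ * (ι 1ℚ + √ t)) (odd-discriminant c) α≈)
  where
  r = seq (√ᴿ (3 ℕ.+ 4 ℕ.* c))
  components : α ≈ ι ½ * (ι 1ℚ + √ -[1+ (2 ℕ.+ 4 ℕ.* c) ]) → α ∈ Form ½ ½ (3 ℕ.+ 4 ℕ.* c)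
  components (re-α , im-α) =
    null-resp (λ n → solve 3 (λ x h r → x :- (h :* (con 1ℚ :+ con 0ℚ) :- con 0ℚ :* (con 0ℚ :+ r)) := x :- h)
                 refl (seq (re α) n) ½ (r n)) re-α ,
    null-resp (λ n → solve 3 (λ y h r → y :- (h :* (con 0ℚ :+ r) :+ con 0ℚ :* (con 1ℚ :+ con 0ℚ)) := y :- h :* r)
                 refl (seq (im α) n) ½ (r n)) im-α

-- This puts the upper end of the odd interval in the form (m + 1)² with m = (n - 1)/2. As n ≥ 1,
-- the truncated subtraction is exact.
half-step : ∀ n .{{_ : NonZero n}} → (n ℕ.+ 1) ℕ./ 2 ≡ suc ((n ℕ.∸ 1) ℕ./ 2)
half-step (suc n) = trans (cong (ℕ._/ 2) (ℕ.+-comm (suc n) 1)) (ℕ.m/n≡1+[m∸n]/n {suc (suc n)} {2} (ℕ.s≤s (ℕ.s≤s ℕ.z≤n)))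

theorem7 : (n : ℕ) .{{_ : NonZero n}} (α β : ℂ) → α ∈ I²ⁱ n → β ∈ I²ⁱ n → α ≉ β → ¬ (ℚ⟨ α ⟩ ≐ ℚ⟨ β ⟩)
theorem7 n α β (odd 2∤n _ _ _ _ _) (even 2∣n _ _ _ _ _) = contradiction 2∣n 2∤n
theorem7 n α β (even 2∣n _ _ _ _ _) (odd 2∤n _ _ _ _ _) = contradiction 2∣n 2∤n
theorem7 n α β (odd _ c c≥ c≤ _ α≈) (odd _ d d≥ d≤ _ β≈) =
  differ (range c c≥ c≤) (range d d≥ d≤)
  where
  m = (n ℕ.∸ 1) ℕ./ 2
  range : ∀ c → (+ m) ℤ.^ 2 ℤ.+ + 1 ℤ.≤ c → c ℤ.≤ (+ ((n ℕ.+ 1) ℕ./ 2)) ℤ.^ 2 →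
    ∃ λ c′ → c ≡ + suc c′ × c′ ∈ OddRange m
  range c c≥ c≤ = odd-range {m} {c} c≥ (subst (λ t → c ℤ.≤ (+ t) ℤ.^ 2) (half-step n) c≤)
  differ : ∃ (λ c′ → c ≡ + suc c′ × c′ ∈ OddRange m) → ∃ (λ d′ → d ≡ + suc d′ × d′ ∈ OddRange m) →
    α ≉ β → ¬ (ℚ⟨ α ⟩ ≐ ℚ⟨ β ⟩)
  differ (c′ , refl , c-range) (d′ , refl , d-range) =
    fields-differ {½} {½} (OddRange m) (λ c → 3 ℕ.+ 4 ℕ.* c)
      (λ {_} {_} {s} (m²≤c , _) (_ , d<m₁²) → no-square-product-3+4c {m} {s = s} m²≤c d<m₁²)
      {c′} {d′} {α} {β} c-range d-range (odd-form {α} c′ α≈) (odd-form {β} d′ β≈)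
theorem7 n α β (even _ c c> c< _ α≈) (even _ d d> d< _ β≈) =
  differ (even-range {m} {c} c> c<) (even-range {m} {d} d> d<)
  where
  m = n ℕ./ 2
  differ : ∃ (λ c′ → c ≡ + suc c′ × c′ ∈ EvenRange m) → ∃ (λ d′ → d ≡ + suc d′ × d′ ∈ EvenRange m) →
    α ≉ β → ¬ (ℚ⟨ α ⟩ ≐ ℚ⟨ β ⟩)
  differ (c′ , refl , c-range) (d′ , refl , d-range) =
    fields-differ {0ℚ} {1ℚ} (EvenRange m) suc
      (λ {_} {_} {s} (m²<c , _) (_ , d<m₁²) c<d →
        -- The radicands are the successors of the indices, so c < d is shifted by one.
        no-square-product-between-squares {m} {s = s} m²<c d<m₁² (ℕ.s<s c<d))
      {c′} {d′} {α} {β} c-range d-range (even-form {α} c′ α≈) (even-form {β} d′ β≈)
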